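{- Let $U=(0,0)$, $A=(192,144)$, $V=(384,0)$, $B=(192,-256)$. Then the set of rational points $P$ on the open segment $UV$ such that the Euclidean distances $PU,PV,PA,PB$ are all rational is exactly $\{(192,0)\}$.
   Context: A rational point is a point with both coordinates in $\mathbb{Q}$. -}

module Defs where

open import Data.Integer.Base using (+_; -_)
open import Data.Product.Base using (_×_; ∃-syntax)
open import Data.Rational.Base using (ℚ; 0ℚ; 1ℚ; _+_; _*_; _-_; _≤_; _<_)
open import Data.Rational.Literals using (fromℤ)
open import Level using (0ℓ)
open import Relation.Binary.PropositionalEquality.Core using (_≡_)
open import Relation.Unary using (Pred)

record RationalPoint : Set where
  constructor ⟨_,_⟩
  field
    x y : ℚ

open RationalPoint public

-- If the points P, Q and R are rational and P ≢ Q, a real parameter t with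
-- R = P + t (Q - P) is itself rational, so ranging over t in ℚ gives exactly the
-- rational points of the real open segment.
OpenSegment : RationalPoint → RationalPoint → Pred RationalPoint 0ℓ
OpenSegment P Q R =
  ∃[ t ] 0ℚ < t × t < 1ℚ
       × R ≡ ⟨ x P + t * (x Q - x P) , y P + t * (y Q - y P) ⟩

distance² : RationalPoint → RationalPoint → ℚ
distance² P Q = (x P - x Q) * (x P - x Q) + (y P - y Q) * (y P - y Q)

-- The Euclidean distance is the nonnegative square root of distance², so it is
-- rational exactly when it is some nonnegative d in ℚ with that square.
RationalDistance : RationalPoint → RationalPoint → Set
RationalDistance P Q = ∃[ d ] 0ℚ ≤ d × d * d ≡ distance² P Q

U A V B : RationalPoint
U = ⟨ fromℤ (+ 0)   , fromℤ (+ 0)       ⟩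
A = ⟨ fromℤ (+ 192) , fromℤ (+ 144)     ⟩
V = ⟨ fromℤ (+ 384) , fromℤ (+ 0)       ⟩
B = ⟨ fromℤ (+ 192) , fromℤ (- (+ 256)) ⟩

{-# OPTIONS --safe #-}

-- With X = x − 192 the conditions say that X² + 144² and X² + 256² are squares; put u = X/16 = p/q, so
-- that p² + 81 q² and p² + 256 q² are squares. The rational solutions u = 0, ±12, ∞ are torsion points
-- of an elliptic curve of rank 0, and u = ±12 are the end points of the segment.
--
-- The core is that q cannot be even and nonzero when p is odd (noEvenPoint). For p, q coprime, s² − p² = 256 q²
-- gives s = b² + 256 c² and q = 2 b c, and s² − r² = 175 q² then splits (s − r)/2 and (s + r)/2 into
-- d₁ x² z² and d₂ y² w² with d₁ d₂ = 175, c = x y, b = z w. Comparing their sum with s yields, after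
-- excluding the bad d₁ modulo 8 and 3, a new such pair with denominator x or y, which is less than q.
-- Every other solution with u ≠ 0, ±12 is moved to one with even denominator by the 4-torsion
-- translation u ↦ 144/u, preceded by a duplication when p is exactly divisible by 4.
module Submission where

open import Defs
open import Data.Empty using (⊥; ⊥-elim)
open import Data.Fin.Base using (Fin; toℕ; fromℕ<)
open import Data.Fin.Properties using (all?; toℕ-fromℕ<)
open import Data.Integer.Base using (+_; -[1+_])
import Data.Integer.Base as ℤ
import Data.Integer.Properties as ℤ
open import Data.List.Base using (List; []; _∷_; filter; upTo)
open import Data.List.Membership.Propositional using (_∈_)
open import Data.List.Membership.Propositional.Properties using (∈-filter⁺; ∈-upTo⁺)
open import Data.List.Relation.Unary.Any using (here; there)
open import Data.Nat.Base hiding (parity; compare)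
open import Data.Nat.Coprimality using (Coprime; coprime-divisor; coprime-factors; GCD≡1⇒coprime)
import Data.Nat.Coprimality as Coprime
open import Data.Nat.Divisibility
open import Data.Nat.DivMod using (_%_; %-distribˡ-+; %-distribˡ-*; m%n<n)
open import Data.Nat.GCD using (module GCD; mkGCD; GCD-*)
open import Data.Nat.Induction using (<-rec)
open import Data.Nat.Primality using (Prime; prime?; prime⇒irreducible; euclidsLemma)
open import Data.Nat.Properties
open import Data.Nat.Tactic.RingSolver using (solve; solve-∀)
open import Data.Product.Base using (_×_; _,_; ∃-syntax; proj₂)
open import Data.Rational.Base using (mkℚ; ↥_; ↧ₙ_; 0ℚ; 1ℚ)
import Data.Rational.Base as ℚ
open import Data.Rational.Literals using (fromℤ)
import Data.Rational.Properties as ℚ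
import Data.Rational.Unnormalised.Base as ℚᵘ
import Data.Rational.Unnormalised.Properties as ℚᵘ
open import Data.Sum.Base using (_⊎_; inj₁; inj₂; [_,_]′; map)
open import Function.Base using (_∘_; id)
open import Relation.Binary.Definitions using (Tri; tri<; tri≈; tri>)
open import Relation.Binary.PropositionalEquality
open import Relation.Nullary using (¬_; Dec; contradiction)
open import Relation.Nullary.Decidable using (from-yes; from-no; _→-dec_)
open import Relation.Unary using (_≐_; ｛_｝)

-- a − b = c − d and c = d give a = b; moving everything to the positive side leaves a
-- semiring identity for the solver.
subtract-equation : ∀ {a b c d} → c ≡ d → a + d ≡ b + c → a ≡ b
subtract-equation {a} {b} {c} refl eq = +-cancelʳ-≡ c a b eq

conjugate : ∀ {a b c d : ℕ} → c ≡ d → a ≡ c → d ≡ b → a ≡ b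
conjugate c≡d a≡c d≡b = trans a≡c (trans c≡d d≡b)

-- Parity, coprimality and divisibility of natural numbers.

Odd : ℕ → Set
Odd n = ¬ 2 ∣ n

even⊎odd : ∀ n → 2 ∣ n ⊎ ∃[ k ] n ≡ 1 + 2 * k
even⊎odd zero = inj₁ (2 ∣0)
even⊎odd (suc n) with even⊎odd n
... | inj₁ (divides k n≡k*2) = inj₂ (k , cong suc (trans n≡k*2 (*-comm k 2)))
... | inj₂ (k , refl)        = inj₁ (divides (suc k) (cong (suc ∘ suc) (*-comm 2 k)))

odd⇒1+2k : ∀ {n} → Odd n → ∃[ k ] n ≡ 1 + 2 * k
odd⇒1+2k {n} odd = [ (λ even → contradiction even odd) , id ]′ (even⊎odd n)

1+2k-odd : ∀ k → Odd (1 + 2 * k)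
1+2k-odd k 2∣1+2k = contradiction
  (∣m+n∣m⇒∣n (subst (2 ∣_) (+-comm 1 (2 * k)) 2∣1+2k) (m∣m*n k))
  λ 2∣1 → contradiction (∣1⇒≡1 2∣1) λ ()

-- With n = 1 + 2 k the square is 1 + 4 k (k + 1), and k (k + 1) is even.
odd-square : ∀ {n} → Odd n → ∃[ t ] n * n ≡ 1 + 8 * t
odd-square odd with odd⇒1+2k odd
... | k , refl with even⊎odd k
...   | inj₁ (divides j refl) = j * (1 + 2 * j) , solve (j ∷ [])
...   | inj₂ (j , refl)       = (1 + 2 * j) * (1 + j) , solve (j ∷ [])

2-prime : Prime 2
2-prime = from-yes (prime? 2)

odd-* : ∀ {m n} → Odd m → Odd n → Odd (m * n)
odd-* {m} {n} odd-m odd-n = [ odd-m , odd-n ]′ ∘ euclidsLemma m n 2-prime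

odd⇒coprime-2 : ∀ {n} → Odd n → Coprime n 2
odd⇒coprime-2 odd (d∣n , d∣2) with prime⇒irreducible 2-prime d∣2
... | inj₁ d≡1  = d≡1
... | inj₂ refl = contradiction d∣n odd

square-even : ∀ {n} → 2 ∣ n * n → 2 ∣ n
square-even {n} = [ id , id ]′ ∘ euclidsLemma n n 2-prime

coprime-∣ˡ : ∀ {d m n} → d ∣ m → Coprime m n → Coprime d n
coprime-∣ˡ d∣m m⊥n (e∣d , e∣n) = m⊥n (∣-trans e∣d d∣m , e∣n)

coprime-∣ʳ : ∀ {d m n} → d ∣ n → Coprime m n → Coprime m d
coprime-∣ʳ d∣n m⊥n (e∣m , e∣d) = m⊥n (e∣m , ∣-trans e∣d d∣n)

coprime-* : ∀ {m n o} → Coprime m n → Coprime m o → Coprime m (n * o)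
coprime-* m⊥n m⊥o (d∣m , d∣n*o) =
  m⊥o (d∣m , coprime-divisor (coprime-∣ˡ d∣m m⊥n) d∣n*o)

coprime-square : ∀ {m n} → Coprime m n → Coprime (m * m) (n * n)
coprime-square m⊥n = coprime-* m²⊥n m²⊥n
  where m²⊥n = Coprime.sym (coprime-* (Coprime.sym m⊥n) (Coprime.sym m⊥n))

*-cancel-∣ : ∀ {k m n} → 0 < k → k * m ∣ k * n → m ∣ n
*-cancel-∣ {k} 0<k = *-cancelˡ-∣ k {{>-nonZero 0<k}}

positiveˡ : ∀ {m n} → 0 < m * n → 0 < m
positiveˡ {suc m} _ = z<s

positiveʳ : ∀ {m n} → 0 < m * n → 0 < n
positiveʳ {m} {n} 0<m*n = positiveˡ (subst (0 <_) (*-comm m n) 0<m*n)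

positive-* : ∀ {m n} → 0 < m → 0 < n → 0 < m * n
positive-* {suc m} {suc n} _ _ = z<s

odd⇒positive : ∀ {n} → Odd n → 0 < n
odd⇒positive {zero}  odd = contradiction (2 ∣0) odd
odd⇒positive {suc n} _   = z<s

coprimeFactors : ∀ m {n} → 0 < n →
  ∃[ g ] ∃[ m′ ] ∃[ n′ ] 0 < g × m ≡ g * m′ × n ≡ g * n′ × Coprime m′ n′
coprimeFactors m {n} 0<n with mkGCD m n
... | g , isGCD with GCD.commonDivisor isGCD
...   | divides m′ refl , divides n′ refl =
        g , m′ , n′ , 0<g , *-comm m′ g , *-comm n′ g ,
        GCD≡1⇒coprime (GCD-* {c = g} {{>-nonZero 0<g}}
          (subst (GCD.GCD (m′ * g) (n′ * g)) (sym (*-identityˡ g)) isGCD))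
  where 0<g = positiveʳ {n′} 0<n

*-cancelˡ-positive : ∀ {k m n} → 0 < k → k * m ≡ k * n → m ≡ n
*-cancelˡ-positive {k} 0<k = *-cancelˡ-≡ _ _ k {{>-nonZero 0<k}}

-- After division by the gcd, m′² and n′² are coprime and the first divides the second, so m′ = 1.
squares-∣⇒∣ : ∀ {m n} → 0 < m → m * m ∣ n * n → m ∣ n
squares-∣⇒∣ {m} {n} 0<m m²∣n² with coprimeFactors n 0<m
... | g , n′ , m′ , 0<g , refl , refl , n′⊥m′ = subst (λ k → g * k ∣ g * n′) (sym m′≡1) (*-monoʳ-∣ g (1∣ n′))
  where
  m′²∣n′² : m′ * m′ ∣ n′ * n′
  m′²∣n′² = *-cancel-∣ (positive-* 0<g 0<g)
    (subst₂ _∣_ ([m*n]*[o*p]≡[m*o]*[n*p] g m′ g m′) ([m*n]*[o*p]≡[m*o]*[n*p] g n′ g n′) m²∣n²)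
  m′≡1 : m′ ≡ 1
  m′≡1 = m*n≡1⇒m≡1 m′ m′ (Coprime.sym (coprime-square n′⊥m′) (∣-refl , m′²∣n′²))

-- For a numeral `n` the list evaluates, so a divisor can be treated case by case by matching on the
-- membership proof.
divisor∈ : ∀ n .{{_ : NonZero n}} {d} → d ∣ n → d ∈ filter (_∣? n) (upTo (suc n))
divisor∈ n d∣n = ∈-filter⁺ (_∣? n) (∈-upTo⁺ (s≤s (∣⇒≤ d∣n))) d∣n

-- x is the part of c going into f: it is gcd f c, and coprimality puts all of x² into f.
splitCoprime : ∀ k c {f g} → 0 < c → Coprime f g → f * g ≡ k * (c * c) →
  ∃[ x ] ∃[ y ] ∃[ f′ ] ∃[ g′ ]
    c ≡ x * y × f ≡ x * x * f′ × g ≡ y * y * g′ × f′ * g′ ≡ k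
splitCoprime k c {f} {g} 0<c f⊥g fg≡kc² with coprimeFactors f 0<c
... | x , f₁ , y , 0<x , refl , refl , f₁⊥y with coprime-divisor {o = f₁} x⊥g x∣g*f₁
  where
  x⊥g : Coprime x g
  x⊥g = coprime-∣ˡ (m∣m*n f₁) f⊥g
  x∣g*f₁ : x ∣ g * f₁
  x∣g*f₁ = divides (k * (y * y)) (*-cancelˡ-positive 0<x
    (conjugate fg≡kc² (solve (x ∷ g ∷ f₁ ∷ [])) (solve (k ∷ x ∷ y ∷ []))))
... | divides f₂ refl with coprime-divisor {o = g} y²⊥f₂ y²∣f₂*g
  where
  y²⊥f₂ : Coprime (y * y) f₂
  y²⊥f₂ = Coprime.sym (coprime-* f₂⊥y f₂⊥y)
    where f₂⊥y = coprime-∣ˡ (m∣m*n x) f₁⊥y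
  y²∣f₂*g : y * y ∣ f₂ * g
  y²∣f₂*g = divides k (*-cancelˡ-positive (positive-* 0<x 0<x)
    (conjugate fg≡kc² (solve (x ∷ g ∷ f₂ ∷ [])) (solve (k ∷ x ∷ y ∷ []))))
... | divides g′ refl = x , y , f₂ , g′ , refl , solve (x ∷ f₂ ∷ []) , *-comm g′ (y * y) ,
  *-cancelˡ-positive (positive-* 0<c 0<c)
    (conjugate fg≡kc² (solve (x ∷ y ∷ g′ ∷ f₂ ∷ [])) (*-comm k (x * y * (x * y))))

∣-difference : ∀ d m n k → d * m + n ≡ d * k → d ∣ n
∣-difference d m n k eq = ∣m+n∣m⇒∣n (divides k (trans eq (*-comm d k))) (m∣m*n m)

-- For a prime p this says that -1 is not a square modulo p, as a finite check over residues. It is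
-- used at 3 and 7.
NoResidue : ℕ → Set
NoResidue zero        = ⊥
NoResidue p@(suc _) = ∀ (i j : Fin p) →
  (toℕ i * toℕ i % p + toℕ j * toℕ j % p) % p ≡ 0 → toℕ i ≡ 0

∣-sum-of-squares : ∀ p → NoResidue p → ∀ a b → p ∣ a * a + b * b → p ∣ a
∣-sum-of-squares p@(suc _) check a b p∣a²+b² =
  m%n≡0⇒n∣m a p (trans (sym (toℕ-fromℕ< a<p)) (check (fromℕ< a<p) (fromℕ< b<p) (begin
    (toℕ (fromℕ< a<p) * toℕ (fromℕ< a<p) % p + toℕ (fromℕ< b<p) * toℕ (fromℕ< b<p) % p) % p
      ≡⟨ cong₂ (λ i j → (i * i % p + j * j % p) % p) (toℕ-fromℕ< a<p) (toℕ-fromℕ< b<p) ⟩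
    ((a % p) * (a % p) % p + (b % p) * (b % p) % p) % p
      ≡⟨ cong₂ (λ i j → (i + j) % p) (%-distribˡ-* a a p) (%-distribˡ-* b b p) ⟨
    (a * a % p + b * b % p) % p
      ≡⟨ %-distribˡ-+ (a * a) (b * b) p ⟨
    (a * a + b * b) % p
      ≡⟨ n∣m⇒m%n≡0 (a * a + b * b) p p∣a²+b² ⟩
    0 ∎)))
  where
  open ≡-Reasoning
  a<p = m%n<n a p
  b<p = m%n<n b p

-- The argument is one less than the modulus: 2 stands for modulus 3 and 6 for modulus 7.
noResidue? : ∀ n → Dec (NoResidue (suc n))
noResidue? n = all? λ i → all? λ j →
  ((toℕ i * toℕ i % suc n + toℕ j * toℕ j % suc n) % suc n ≟ 0) →-dec (toℕ i ≟ 0)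

-- Even points and the equation of the descent.

-- u = p/q is a rational number with q even for which u² + 81 and u² + 256 are squares; p and q
-- may still have a common (odd) factor.
EvenPoint : ℕ → Set
EvenPoint q = ∃[ p ] ∃[ r ] ∃[ s ]
  Odd p × 2 ∣ q × p * p + 81 * (q * q) ≡ r * r × p * p + 256 * (q * q) ≡ s * s

-- m (a − d) = n (b − c) with m, n coprime, so a − d = e n and b − c = e m.
commonQuotient : ∀ {m n a b c d} → Coprime m n → 0 < m →
  m * a + n * c ≡ n * b + m * d → c ≤ b →
  ∃[ e ] b ≡ c + e * m × a ≡ e * n + d
commonQuotient {m} {n} {a} {b} {c} {d} m⊥n 0<m eq c≤b with m≤n⇒∃[o]m+o≡n c≤b
... | t , refl with coprime-divisor {o = t} m⊥n m∣n*t
  where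
  ma≡nt+md : m * a ≡ n * t + m * d
  ma≡nt+md = subtract-equation eq (solve (m ∷ n ∷ a ∷ c ∷ d ∷ t ∷ []))
  m∣n*t : m ∣ n * t
  m∣n*t = ∣m+n∣m⇒∣n (divides a (conjugate (sym ma≡nt+md) (+-comm (m * d) (n * t)) (*-comm m a)))
                      (m∣m*n d)
... | divides e refl = e , refl , *-cancelˡ-positive 0<m
  (subtract-equation eq (solve (m ∷ n ∷ a ∷ c ∷ d ∷ e ∷ [])))

-- Elimination of Z and then of Y, with 81 = 256 - 175. The second relation is kept as an equation
-- because `nextPoint` needs it.
positive-divisor : ∀ d₁ d₂ e {X Y Z W} → d₁ * d₂ ≡ 175 →
  d₂ * Y ≡ Z + e * X → 256 * Y ≡ e * W + d₁ * Z →
  e ∣ 81 * Y × e * (256 * X) + 81 * Z ≡ e * (d₂ * W)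
positive-divisor d₁ d₂ e {X} {Y} {Z} {W} d₁d₂≡175 eq₁ eq₂ =
  ∣-difference e (d₁ * X) (81 * Y) W 81Y ,
  subtract-equation (cong₂ _+_ (cong₂ _+_ (cong (256 *_) (sym eq₁)) (cong (d₂ *_) eq₂)) (cong (_* Z) d₁d₂≡175))
    (solve (d₁ ∷ d₂ ∷ e ∷ X ∷ Y ∷ Z ∷ W ∷ []))
  where
  81Y : e * (d₁ * X) + 81 * Y ≡ e * W
  81Y = subtract-equation (cong₂ _+_ (cong₂ _+_ (cong (d₁ *_) (sym eq₁)) eq₂) (cong (_* Y) d₁d₂≡175))
    (solve (d₁ ∷ d₂ ∷ e ∷ X ∷ Y ∷ Z ∷ W ∷ []))

negative-divisor : ∀ d₁ d₂ e {X Y Z W} → d₁ * d₂ ≡ 175 →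
  Z ≡ d₂ * Y + e * X → d₁ * Z ≡ e * W + 256 * Y →
  e ∣ 81 * Y × e ∣ 81 * Z
negative-divisor d₁ d₂ e {X} {Y} {Z} {W} d₁d₂≡175 eq₁ eq₂ =
  ∣-difference e W (81 * Y) (d₁ * X) 81Y ,
  ∣-difference e (d₂ * W) (81 * Z) (256 * X) 81Z
  where
  81Y : e * W + 81 * Y ≡ e * (d₁ * X)
  81Y = subtract-equation (cong₂ _+_ (cong₂ _+_ (cong (d₁ *_) eq₁) (sym eq₂)) (cong (_* Y) d₁d₂≡175))
    (solve (d₁ ∷ d₂ ∷ e ∷ X ∷ Y ∷ Z ∷ W ∷ []))
  81Z : e * (d₂ * W) + 81 * Z ≡ e * (256 * X)
  81Z = subtract-equation (cong₂ _+_ (cong₂ _+_ (cong (256 *_) eq₁) (cong (d₂ *_) (sym eq₂))) (cong (_* Z) d₁d₂≡175))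
    (solve (d₁ ∷ d₂ ∷ e ∷ X ∷ Y ∷ Z ∷ W ∷ []))

positive-mod-8 : ∀ d₁ e Y a b → 256 * Y ≡ e * (1 + 8 * b) + d₁ * (1 + 8 * a) → 8 ∣ e + d₁
positive-mod-8 d₁ e Y a b eq = ∣-difference 8 (e * b + d₁ * a) (e + d₁) (32 * Y)
  (subtract-equation (sym eq) (solve (d₁ ∷ e ∷ Y ∷ a ∷ b ∷ [])))

-- The factor 7 stands for -1 modulo 8: the equation gives e ≡ d₁.
negative-mod-8 : ∀ d₁ e Y a b → d₁ * (1 + 8 * a) ≡ e * (1 + 8 * b) + 256 * Y → 8 ∣ e + 7 * d₁
negative-mod-8 d₁ e Y a b eq = ∣-difference 8 (e * b + 32 * Y) (e + 7 * d₁) (d₁ + d₁ * a)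
  (subtract-equation (sym eq) (solve (d₁ ∷ e ∷ Y ∷ a ∷ b ∷ [])))

divisors-of-81 : ℕ → List ℕ
divisors-of-81 a = filter (λ e → 8 ∣? e + a) (filter (_∣? 81) (upTo 82))

∈-divisors-of-81 : ∀ a {e} → e ∣ 81 × 8 ∣ e + a → e ∈ divisors-of-81 a
∈-divisors-of-81 a (e∣81 , 8∣e+a) = ∈-filter⁺ (λ e → 8 ∣? e + a) (divisor∈ 81 e∣81) 8∣e+a

divides-81 : ∀ {e y z} → Coprime y z → e ∣ 81 * (y * y) → e ∣ 81 * (z * z) → e ∣ 81
divides-81 {e} {y} {z} y⊥z e∣81y² e∣81z² = coprime-factors {o = 81} (coprime-square y⊥z)
  (subst (e ∣_) (*-comm 81 (y * y)) e∣81y² , subst (e ∣_) (*-comm 81 (z * z)) e∣81z²)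

-- The right side is 2 modulo 4, while an odd multiple of a square is odd or divisible by 4.
odd-*-square≢2+8k : ∀ {d} y k → Odd d → d * (y * y) ≢ 2 + 8 * k
odd-*-square≢2+8k {d} y k odd-d eq =
  [ odd-d , odd-y ∘ square-even ]′ (euclidsLemma d (y * y) 2-prime 2∣dy²)
  where
  2∣dy² : 2 ∣ d * (y * y)
  2∣dy² = subst (2 ∣_) (sym eq) (∣m∣n⇒∣m+n ∣-refl (∣m⇒∣m*n k (divides 4 refl)))
  odd-y : Odd y
  odd-y (divides j refl) = from-no (4 ∣? 2)
    (∣-difference 4 (2 * k) 2 (d * (j * j)) (subtract-equation (sym eq) (solve (d ∷ j ∷ k ∷ []))))

-- For odd x the right side would be 2 modulo 8. This makes the denominator of the next point even.
even-leg : ∀ {d e′ x y z} → Odd d → Odd z → d * (y * y) ≡ z * z + (1 + 8 * e′) * (x * x) → 2 ∣ x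
even-leg {d} {e′} {x} {y} {z} odd-d odd-z eq with even⊎odd x
... | inj₁ 2∣x          = 2∣x
... | inj₂ (k , refl) with odd-square odd-z | odd-square (1+2k-odd k)
...   | a , z²≡1+8a | b , x²≡1+8b = contradiction
        (trans eq (trans (cong₂ (λ Z X → Z + (1 + 8 * e′) * X) z²≡1+8a x²≡1+8b) (collect a b e′)))
        (odd-*-square≢2+8k y (a + b + e′ + 8 * (e′ * b)) odd-d)
  where
  collect : ∀ a b e′ → 1 + 8 * a + (1 + 8 * e′) * (1 + 8 * b) ≡ 2 + 8 * (a + b + e′ + 8 * (e′ * b))
  collect = solve-∀

-- Multiplication by m², where m is the root of 81/e, turns e x² into 81 x², the term required in an
-- even point.
SquareCofactor : ℕ → Set
SquareCofactor e = ∃[ m ] ∃[ e′ ] e ≡ 1 + 8 * e′ × m * m * (1 + 8 * e′) ≡ 81 × Odd m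

squareCofactor : ∀ {e} → e ∈ 1 ∷ 9 ∷ 81 ∷ [] → SquareCofactor e
squareCofactor (here refl)                 = 9 , 0 , refl , refl , 1+2k-odd 4
squareCofactor (there (here refl))         = 3 , 1 , refl , refl , 1+2k-odd 1
squareCofactor (there (there (here refl))) = 1 , 10 , refl , refl , 1+2k-odd 0

-- The equation is x² (256 y² − d₁ z²) = w² (d₂ y² − z²), hence d₂ y² − z² = ± e x² and
-- 256 y² − d₁ z² = ± e w² for some e. The determinant of the two quadratic forms is
-- d₁ d₂ − 256 = −81, which forces e ∣ 81, while the parity of z and w determines e modulo 8.
module Descent {x y z w d₁ d₂ : ℕ}
  (0<x : 0 < x) (x⊥w : Coprime x w) (y⊥z : Coprime y z)
  (odd-z : Odd z) (odd-w : Odd w)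
  (d₁d₂≡175 : d₁ * d₂ ≡ 175)
  (eq : d₁ * (x * x * (z * z)) + d₂ * (y * y * (w * w))
      ≡ z * z * (w * w) + 256 * (x * x * (y * y)))
  where

  Pos Neg : ℕ → Set
  Pos e = d₂ * (y * y) ≡ z * z + e * (x * x) × 256 * (y * y) ≡ e * (w * w) + d₁ * (z * z)
  Neg e = z * z ≡ d₂ * (y * y) + e * (x * x) × d₁ * (z * z) ≡ e * (w * w) + 256 * (y * y)

  posOrNeg : (∃[ e ] Pos e) ⊎ (∃[ e ] Neg e)
  posOrNeg = map
    (commonQuotient {m = x * x} {n = w * w} {a = 256 * (y * y)} {d = d₁ * (z * z)} (coprime-square x⊥w) (positive-* 0<x 0<x)
      (subtract-equation (sym eq) (solve (x ∷ y ∷ z ∷ w ∷ d₁ ∷ d₂ ∷ []))))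
    (commonQuotient {m = x * x} {n = w * w} {a = d₁ * (z * z)} {d = 256 * (y * y)} (coprime-square x⊥w) (positive-* 0<x 0<x)
      (subtract-equation eq (solve (x ∷ y ∷ z ∷ w ∷ d₁ ∷ d₂ ∷ []))))
    (≤-total (z * z) (d₂ * (y * y)))

  posDivisor : ∀ {e} → Pos e → e ∣ 81 × 8 ∣ e + d₁
  posDivisor {e} (eq₁ , eq₂) =
    let a , z²≡1+8a = odd-square odd-z
        b , w²≡1+8b = odd-square odd-w
        e∣81y² , eq₃ = positive-divisor d₁ d₂ e d₁d₂≡175 eq₁ eq₂
    in divides-81 y⊥z e∣81y² (∣-difference e (256 * (x * x)) (81 * (z * z)) (d₂ * (w * w)) eq₃) ,
       positive-mod-8 d₁ e (y * y) a b (subst₂ (λ W Z → 256 * (y * y) ≡ e * W + d₁ * Z) w²≡1+8b z²≡1+8a eq₂)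

  negDivisor : ∀ {e} → Neg e → e ∣ 81 × 8 ∣ e + 7 * d₁
  negDivisor {e} (eq₁ , eq₂) =
    let a , z²≡1+8a = odd-square odd-z
        b , w²≡1+8b = odd-square odd-w
        e∣81y² , e∣81z² = negative-divisor d₁ d₂ e d₁d₂≡175 eq₁ eq₂
    in divides-81 y⊥z e∣81y² e∣81z² ,
       negative-mod-8 d₁ e (y * y) a b (subst₂ (λ W Z → d₁ * Z ≡ e * W + 256 * (y * y)) w²≡1+8b z²≡1+8a eq₂)

  -- For d₂ = k², m² times the first equation is (m z)² + 81 x² = (m k y)². Elimination of y² gives
  -- e times (m z)² + 256 x² = (k w)², and e is cancelled.
  nextPoint : ∀ k {e} → d₂ ≡ k * k → Odd d₂ → SquareCofactor e → Pos e → EvenPoint x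
  nextPoint k d₂≡k² odd-d₂ (m , e′ , refl , m²e≡81 , odd-m) (eq₁ , eq₂) =
    m * z , m * k * y , k * w , odd-* odd-m odd-z , even-leg {e′ = e′} {y = y} odd-d₂ odd-z eq₁ ,
    r-eq m k z y (x * x) (1 + 8 * e′) d₂ d₂≡k² m²e≡81 eq₁ ,
    *-cancelˡ-positive {1 + 8 * e′} z<s (s-eq m k z w (x * x) (1 + 8 * e′) d₂ d₂≡k² m²e≡81
      (proj₂ (positive-divisor d₁ d₂ (1 + 8 * e′) d₁d₂≡175 eq₁ eq₂)))
    where
    r-eq : ∀ m k z y X e d → d ≡ k * k → m * m * e ≡ 81 → d * (y * y) ≡ z * z + e * X →
      m * z * (m * z) + 81 * X ≡ m * k * y * (m * k * y)
    r-eq m k z y X e d h₁ h₂ h₃ = subtract-equation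
      (cong₂ _+_ (cong₂ _+_ (cong (m * m *_) (sym h₃)) (cong (λ d → m * m * (d * (y * y))) h₁)) (cong (_* X) (sym h₂)))
      (solve (m ∷ k ∷ z ∷ y ∷ X ∷ e ∷ d ∷ []))
    s-eq : ∀ m k z w X e d → d ≡ k * k → m * m * e ≡ 81 → e * (256 * X) + 81 * (z * z) ≡ e * (d * (w * w)) →
      e * (m * z * (m * z) + 256 * X) ≡ e * (k * w * (k * w))
    s-eq m k z w X e d h₁ h₂ h₃ = subtract-equation
      (cong₂ _+_ (cong₂ _+_ h₃ (cong (λ d → e * (d * (w * w))) h₁)) (cong (_* (z * z)) h₂))
      (solve (m ∷ k ∷ z ∷ w ∷ X ∷ e ∷ d ∷ []))

-- Modulo 3, e vanishes, 35 is -1 and 256 is 1, so 3 divides y² + z² and hence both y and z.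
mod-3-obstruction : ∀ {e y z w} → e ∈ 3 ∷ 27 ∷ [] → Coprime y z →
  35 * (z * z) ≢ e * (w * w) + 256 * (y * y)
mod-3-obstruction {e} {y} {z} {w} e∈ y⊥z eq = contradiction
  (y⊥z (∣-sum-of-squares 3 (from-yes (noResidue? 2)) y z 3∣y²+z² ,
        ∣-sum-of-squares 3 (from-yes (noResidue? 2)) z y (subst (3 ∣_) (+-comm (y * y) (z * z)) 3∣y²+z²)))
  λ ()
  where
  3∣e : ∀ {e} → e ∈ 3 ∷ 27 ∷ [] → 3 ∣ e
  3∣e (here refl)         = divides 1 refl
  3∣e (there (here refl)) = divides 9 refl
  3∣y²+z² : 3 ∣ y * y + z * z
  3∣y²+z² = ∣m+n∣m⇒∣n (subst (3 ∣_) (rearrange (e * (w * w)) (y * y) (z * z) eq) (m∣m*n (12 * (z * z))))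
    (∣m∣n⇒∣m+n (∣m⇒∣m*n (w * w) (3∣e e∈)) (m∣m*n (85 * (y * y))))
    where
    rearrange : ∀ E Y Z → 35 * Z ≡ E + 256 * Y → 3 * (12 * Z) ≡ E + 3 * (85 * Y) + (Y + Z)
    rearrange E Y Z eq = subtract-equation eq (solve (E ∷ Y ∷ Z ∷ []))

-- Divisors of 81 are 1 or 3 modulo 8. As 175 is 7 modulo 8, the positive sign needs e ≡ 1, so e is
-- 1, 9 or 81, and the negative sign needs e ≡ 7, which does not occur. The number 1225 is 7 · 175.
descent-175-1 : ∀ {x y z w} → 0 < x → Coprime x w → Coprime y z → Odd z → Odd w →
  175 * (x * x * (z * z)) + 1 * (y * y * (w * w)) ≡ z * z * (w * w) + 256 * (x * x * (y * y)) → EvenPoint x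
descent-175-1 0<x x⊥w y⊥z odd-z odd-w eq = [ positive , negative ]′ posOrNeg
  where
  open Descent {d₁ = 175} {1} 0<x x⊥w y⊥z odd-z odd-w refl eq
  positive : ∃[ e ] Pos e → EvenPoint _
  positive (e , pos) = nextPoint 1 {e} refl (1+2k-odd 0) (squareCofactor (∈-divisors-of-81 175 (posDivisor {e} pos))) pos
  negative : ∃[ e ] Neg e → EvenPoint _
  negative (e , neg) = contradiction (∈-divisors-of-81 1225 (negDivisor {e} neg)) λ ()

descent-7-25 : ∀ {x y z w} → 0 < x → Coprime x w → Coprime y z → Odd z → Odd w →
  7 * (x * x * (z * z)) + 25 * (y * y * (w * w)) ≡ z * z * (w * w) + 256 * (x * x * (y * y)) → EvenPoint x
descent-7-25 0<x x⊥w y⊥z odd-z odd-w eq = [ positive , negative ]′ posOrNeg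
  where
  open Descent {d₁ = 7} {25} 0<x x⊥w y⊥z odd-z odd-w refl eq
  positive : ∃[ e ] Pos e → EvenPoint _
  positive (e , pos) = nextPoint 5 {e} refl (1+2k-odd 12) (squareCofactor (∈-divisors-of-81 7 (posDivisor {e} pos))) pos
  negative : ∃[ e ] Neg e → EvenPoint _
  negative (e , neg) = contradiction (∈-divisors-of-81 49 (negDivisor {e} neg)) λ ()

-- As 35 is 3 modulo 8, the positive sign needs e ≡ 5, which does not occur. The negative sign
-- leaves e = 3 and e = 27, which fail modulo 3.
descent-35-5 : ∀ {x y z w} → 0 < x → Coprime x w → Coprime y z → Odd z → Odd w →
  35 * (x * x * (z * z)) + 5 * (y * y * (w * w)) ≢ z * z * (w * w) + 256 * (x * x * (y * y))
descent-35-5 {x} {y} {z} {w} 0<x x⊥w y⊥z odd-z odd-w eq = [ positive , negative ]′ posOrNeg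
  where
  open Descent {d₁ = 35} {5} 0<x x⊥w y⊥z odd-z odd-w refl eq
  positive : ¬ (∃[ e ] Pos e)
  positive (e , pos) = contradiction (∈-divisors-of-81 35 (posDivisor {e} pos)) λ ()
  negative : ¬ (∃[ e ] Neg e)
  negative (e , neg) = mod-3-obstruction {e} {y} {z} {w} (∈-divisors-of-81 245 (negDivisor {e} neg)) y⊥z (proj₂ neg)

-- Exchanging (x, z, d₁) with (y, w, d₂) preserves the equation, so the six divisors of 175 reduce
-- to the pairs (175, 1), (7, 25) and (35, 5).
descent : ∀ {x y z w d₁ d₂} → 0 < x → 0 < y → Coprime x w → Coprime y z → Odd z → Odd w →
  d₁ * d₂ ≡ 175 →
  d₁ * (x * x * (z * z)) + d₂ * (y * y * (w * w)) ≡ z * z * (w * w) + 256 * (x * x * (y * y)) →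
  EvenPoint x ⊎ EvenPoint y
descent {x} {y} {z} {w} {d₁} {d₂} 0<x 0<y x⊥w y⊥z odd-z odd-w d₁d₂≡175 eq =
  cases d₂ (divisor∈ 175 (divides d₂ (trans (sym d₁d₂≡175) (*-comm d₁ d₂)))) d₁d₂≡175 eq
  where
  Equation : ℕ → ℕ → Set
  Equation d₁ d₂ = d₁ * (x * x * (z * z)) + d₂ * (y * y * (w * w)) ≡ z * z * (w * w) + 256 * (x * x * (y * y))
  swapped : ∀ {d₁ d₂} → Equation d₁ d₂ →
    d₂ * (y * y * (w * w)) + d₁ * (x * x * (z * z)) ≡ w * w * (z * z) + 256 * (y * y * (x * x))
  swapped {d₁} {d₂} eq = trans (+-comm (d₂ * (y * y * (w * w))) (d₁ * (x * x * (z * z))))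
    (trans eq (cong₂ _+_ (*-comm (z * z) (w * w)) (cong (256 *_) (*-comm (x * x) (y * y)))))
  at : ∀ d₁ n .{{_ : NonZero d₁}} d₂ → d₁ * d₂ ≡ d₁ * n → Equation d₁ d₂ → Equation d₁ n
  at d₁ n d₂ d₁d₂≡d₁n = subst (Equation d₁) (*-cancelˡ-≡ d₂ n d₁ d₁d₂≡d₁n)
  cases : ∀ {d₁} d₂ → d₁ ∈ 1 ∷ 5 ∷ 7 ∷ 25 ∷ 35 ∷ 175 ∷ [] → d₁ * d₂ ≡ 175 → Equation d₁ d₂ →
    EvenPoint x ⊎ EvenPoint y
  cases d₂ (here refl) d₁d₂ eq =
    inj₂ (descent-175-1 0<y y⊥z x⊥w odd-w odd-z (swapped {1} {175} (at 1 175 d₂ d₁d₂ eq)))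
  cases d₂ (there (here refl)) d₁d₂ eq =
    ⊥-elim (descent-35-5 0<y y⊥z x⊥w odd-w odd-z (swapped {5} {35} (at 5 35 d₂ d₁d₂ eq)))
  cases d₂ (there (there (here refl))) d₁d₂ eq =
    inj₁ (descent-7-25 0<x x⊥w y⊥z odd-z odd-w (at 7 25 d₂ d₁d₂ eq))
  cases d₂ (there (there (there (here refl)))) d₁d₂ eq =
    inj₂ (descent-7-25 0<y y⊥z x⊥w odd-w odd-z (swapped {25} {7} (at 25 7 d₂ d₁d₂ eq)))
  cases d₂ (there (there (there (there (here refl))))) d₁d₂ eq =
    ⊥-elim (descent-35-5 0<x x⊥w y⊥z odd-z odd-w (at 35 5 d₂ d₁d₂ eq))
  cases d₂ (there (there (there (there (there (here refl)))))) d₁d₂ eq =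
    inj₁ (descent-175-1 0<x x⊥w y⊥z odd-z odd-w (at 175 1 d₂ d₁d₂ eq))

-- From an even point to the equation of the descent.

splitSquares : ∀ k b c {f g} → 0 < b → 0 < c → Coprime f g → f * g ≡ k * (b * b) * (c * c) →
  ∃[ x ] ∃[ y ] ∃[ z ] ∃[ w ] ∃[ k₁ ] ∃[ k₂ ]
    c ≡ x * y × b ≡ z * w × f ≡ x * x * (z * z * k₁) × g ≡ y * y * (w * w * k₂) × k₁ * k₂ ≡ k
splitSquares k b c 0<b 0<c f⊥g fg with splitCoprime (k * (b * b)) c 0<c f⊥g fg
... | x , y , f′ , g′ , c≡xy , refl , refl , f′g′ with splitCoprime k b 0<b f′⊥g′ f′g′
  where
  f′⊥g′ : Coprime f′ g′
  f′⊥g′ = coprime-∣ˡ (n∣m*n (x * x)) (coprime-∣ʳ (n∣m*n (y * y)) f⊥g)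
... | z , w , k₁ , k₂ , b≡zw , refl , refl , k₁k₂ =
  x , y , z , w , k₁ , k₂ , c≡xy , b≡zw , refl , refl , k₁k₂

-- The bound is not strict; strict decrease comes from c < 2 b c = q in `descentCoprime`.
SmallerEvenPoint : ℕ → Set
SmallerEvenPoint c = ∃[ q ] 0 < q × q ≤ c × EvenPoint q

-- The common factor d goes back into d₁ = d k₁ and d₂ = d k₂, whose product is d² k = 175.
descentFromSplit : ∀ d k x y z w k₁ k₂ → d * d * k ≡ 175 → k₁ * k₂ ≡ k →
  0 < x * y → Coprime (x * x * (z * z * k₁)) (y * y * (w * w * k₂)) → Odd (z * w) →
  d * (x * x * (z * z * k₁)) + d * (y * y * (w * w * k₂)) ≡ z * w * (z * w) + 256 * (x * y * (x * y)) →
  SmallerEvenPoint (x * y)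
descentFromSplit d k x y z w k₁ k₂ d²k k₁k₂ 0<xy f⊥g odd-zw eq =
  [ (λ point → x , 0<x , m≤m*n x y {{>-nonZero 0<y}} , point) ,
    (λ point → y , 0<y , m≤n*m y x {{>-nonZero 0<x}} , point) ]′
  (descent {x} {y} {z} {w} {d * k₁} {d * k₂} 0<x 0<y
    (coprime-∣ˡ x∣f (coprime-∣ʳ w∣g f⊥g)) (Coprime.sym (coprime-∣ˡ z∣f (coprime-∣ʳ y∣g f⊥g)))
    (odd-zw ∘ ∣m⇒∣m*n w) (odd-zw ∘ ∣n⇒∣m*n z)
    (trans (regroup d k₁ k₂) (trans (cong (d * d *_) k₁k₂) d²k))
    (conjugate eq (lhs x y z w d k₁ k₂) (rhs x y z w)))
  where
  0<x = positiveˡ {x} 0<xy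
  0<y = positiveʳ {x} 0<xy
  x∣f : x ∣ x * x * (z * z * k₁)
  x∣f = ∣m⇒∣m*n (z * z * k₁) (m∣m*n x)
  z∣f : z ∣ x * x * (z * z * k₁)
  z∣f = ∣n⇒∣m*n (x * x) (∣m⇒∣m*n k₁ (m∣m*n z))
  y∣g : y ∣ y * y * (w * w * k₂)
  y∣g = ∣m⇒∣m*n (w * w * k₂) (m∣m*n y)
  w∣g : w ∣ y * y * (w * w * k₂)
  w∣g = ∣n⇒∣m*n (y * y) (∣m⇒∣m*n k₂ (m∣m*n w))
  regroup : ∀ d k₁ k₂ → d * k₁ * (d * k₂) ≡ d * d * (k₁ * k₂)
  regroup = solve-∀
  lhs : ∀ x y z w d k₁ k₂ → d * k₁ * (x * x * (z * z)) + d * k₂ * (y * y * (w * w))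
    ≡ d * (x * x * (z * z * k₁)) + d * (y * y * (w * w * k₂))
  lhs = solve-∀
  rhs : ∀ x y z w → z * w * (z * w) + 256 * (x * y * (x * y)) ≡ z * z * (w * w) + 256 * (x * x * (y * y))
  rhs = solve-∀

descentFromCoprime : ∀ d k b c f g → d * d * k ≡ 175 → 0 < c → Odd b → Coprime f g →
  f * g ≡ k * (b * b) * (c * c) → d * f + d * g ≡ b * b + 256 * (c * c) → SmallerEvenPoint c
descentFromCoprime d k b c f g d²k 0<c odd-b f⊥g fg sum =
  assemble (splitSquares k b c (odd⇒positive odd-b) 0<c f⊥g fg) 0<c f⊥g odd-b sum
  where
  assemble : ∀ {b c f g} → (∃[ x ] ∃[ y ] ∃[ z ] ∃[ w ] ∃[ k₁ ] ∃[ k₂ ]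
    c ≡ x * y × b ≡ z * w × f ≡ x * x * (z * z * k₁) × g ≡ y * y * (w * w * k₂) × k₁ * k₂ ≡ k) →
    0 < c → Coprime f g → Odd b → d * f + d * g ≡ b * b + 256 * (c * c) → SmallerEvenPoint c
  assemble (x , y , z , w , k₁ , k₂ , refl , refl , refl , refl , k₁k₂) =
    descentFromSplit d k x y z w k₁ k₂ d²k k₁k₂

-- The gcd d of f and g divides f + g = b² + (16 c)². As b and 16 c are coprime, d is coprime to
-- both, and also to 7, modulo which -1 is not a square. Since d² divides 175 b² c², it divides 25,
-- so d is 1 or 5.
descentFromFactors : ∀ b c f g → 0 < c → 0 < g → Odd b → Coprime b (16 * c) →
  f * g ≡ 175 * (b * b * (c * c)) → f + g ≡ b * b + 256 * (c * c) → SmallerEvenPoint c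
descentFromFactors b c f g 0<c 0<g odd-b b⊥16c fg sum = split (coprimeFactors f 0<g) fg sum
  where
  C = 16 * c
  sum-of-squares : ∀ b c → b * b + 256 * (c * c) ≡ b * b + 16 * c * (16 * c)
  sum-of-squares = solve-∀
  S⊥b : ∀ {d} → d ∣ b * b + C * C → Coprime d b
  S⊥b d∣S (e∣d , e∣b) = coprime-* b⊥16c b⊥16c
    (e∣b , ∣m+n∣m⇒∣n (∣-trans e∣d d∣S) (∣m⇒∣m*n b e∣b))
  S⊥C : ∀ {d} → d ∣ b * b + C * C → Coprime d C
  S⊥C d∣S {e} (e∣d , e∣C) = coprime-* (Coprime.sym b⊥16c) (Coprime.sym b⊥16c)
    (e∣C , ∣m+n∣m⇒∣n (subst (e ∣_) (+-comm (b * b) (C * C)) (∣-trans e∣d d∣S)) (∣m⇒∣m*n C e∣C))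
  S⊥7 : ∀ {d} → d ∣ b * b + C * C → Coprime d 7
  S⊥7 d∣S (e∣d , e∣7) with prime⇒irreducible (from-yes (prime? 7)) e∣7
  ... | inj₁ e≡1  = e≡1
  ... | inj₂ refl = contradiction
    (b⊥16c (∣-sum-of-squares 7 (from-yes (noResidue? 6)) b C 7∣S ,
            ∣-sum-of-squares 7 (from-yes (noResidue? 6)) C b (subst (7 ∣_) (+-comm (b * b) (C * C)) 7∣S)))
    λ ()
    where 7∣S = ∣-trans e∣d d∣S
  split : ∀ {f g} → (∃[ d ] ∃[ f′ ] ∃[ g′ ] 0 < d × f ≡ d * f′ × g ≡ d * g′ × Coprime f′ g′) →
    f * g ≡ 175 * (b * b * (c * c)) → f + g ≡ b * b + 256 * (c * c) → SmallerEvenPoint c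
  split (d , f′ , g′ , 0<d , refl , refl , f′⊥g′) fg sum = finish (prime⇒irreducible (from-yes (prime? 5)) d∣5)
    where
    d∣S : d ∣ b * b + C * C
    d∣S = subst (d ∣_) (trans sum (sum-of-squares b c)) (∣m∣n⇒∣m+n (m∣m*n f′) (m∣m*n g′))
    d⊥bc : Coprime d (b * b * (c * c))
    d⊥bc = coprime-* (coprime-* (S⊥b d∣S) (S⊥b d∣S)) (coprime-* d⊥c d⊥c)
      where d⊥c = coprime-∣ʳ {c} (n∣m*n 16) (S⊥C d∣S)
    d²⊥ : Coprime (d * d) (7 * (b * b * (c * c)))
    d²⊥ = Coprime.sym (coprime-* d⊥ d⊥)
      where d⊥ = Coprime.sym (coprime-* (S⊥7 d∣S) d⊥bc)
    regroup : ∀ d f g → f * g * (d * d) ≡ d * f * (d * g)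
    regroup = solve-∀
    regroup′ : ∀ n → 175 * n ≡ 7 * n * (5 * 5)
    regroup′ = solve-∀
    d∣5 : d ∣ 5
    d∣5 = squares-∣⇒∣ 0<d (coprime-divisor d²⊥ (divides (f′ * g′)
      (sym (trans (regroup d f′ g′) (trans fg (regroup′ (b * b * (c * c))))))))
    finish : d ≡ 1 ⊎ d ≡ 5 → SmallerEvenPoint c
    finish (inj₁ refl) = descentFromCoprime 1 175 b c f′ g′ refl 0<c odd-b f′⊥g′
      (trans (scale f′ g′) (trans fg (sym (*-assoc 175 (b * b) (c * c))))) sum
      where
      scale : ∀ f g → f * g ≡ 1 * f * (1 * g)
      scale = solve-∀
    finish (inj₂ refl) = descentFromCoprime 5 7 b c f′ g′ refl 0<c odd-b f′⊥g′
      (trans (*-cancelˡ-≡ (f′ * g′) (7 * (b * b * (c * c))) 25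
        (trans (scale f′ g′) (trans fg (regroup″ (b * b * (c * c))))))
        (sym (*-assoc 7 (b * b) (c * c)))) sum
      where
      scale : ∀ f g → 25 * (f * g) ≡ 5 * f * (5 * g)
      scale = solve-∀
      regroup″ : ∀ n → 175 * n ≡ 25 * (7 * n)
      regroup″ = solve-∀

square-cancel-≤ : ∀ {m n} → m * m ≤ n * n → m ≤ n
square-cancel-≤ {m} {n} m²≤n² = ≮⇒≥ λ n<m → <⇒≱ (*-mono-< n<m n<m) m²≤n²

square-injective : ∀ {m n} → m * m ≡ n * n → m ≡ n
square-injective eq = ≤-antisym (square-cancel-≤ (≤-reflexive eq)) (square-cancel-≤ (≤-reflexive (sym eq)))

odd-root : ∀ {p k r} → Odd p → 2 ∣ k → p * p + k ≡ r * r → Odd r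
odd-root {p} {k} {r} odd-p 2∣k eq 2∣r = odd-* odd-p odd-p
  (∣m+n∣m⇒∣n (subst (2 ∣_) (trans (sym eq) (+-comm (p * p) k)) (∣m⇒∣m*n r 2∣r)) 2∣k)

odd-gap : ∀ {m n} → Odd m → Odd n → m ≤ n → ∃[ k ] n ≡ m + 2 * k
odd-gap {m} odd-m odd-n m≤n with m≤n⇒∃[o]m+o≡n m≤n
... | t , refl with even⊎odd t | odd⇒1+2k odd-m
...   | inj₁ (divides k refl) | _ = k , cong (λ n → m + n) (*-comm k 2)
...   | inj₂ (k , refl) | i , refl = contradiction (divides (1 + i + k) (even i k)) odd-n
  where
  even : ∀ i k → 1 + 2 * i + (1 + 2 * k) ≡ (1 + i + k) * 2
  even = solve-∀

-- With f = (s - r)/2 and r + f = (s + r)/2, the difference s² - r² gives the product 175 b² c², and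
-- the sum of the two is s.
descentFromLegs : ∀ b c r s → 0 < c → Odd b → Coprime b (16 * c) → Odd r →
  s ≡ b * b + 256 * (c * c) → r * r + 175 * (2 * (b * c) * (2 * (b * c))) ≡ s * s → SmallerEvenPoint c
descentFromLegs b c r s 0<c odd-b b⊥16c odd-r s≡ eq = finish (odd-gap odd-r odd-s r≤s) s≡ eq
  where
  odd-s : Odd s
  odd-s = odd-root odd-r (∣n⇒∣m*n 175 (∣m⇒∣m*n (2 * (b * c)) (m∣m*n (b * c)))) eq
  r≤s : r ≤ s
  r≤s = square-cancel-≤ (subst (r * r ≤_) eq (m≤m+n (r * r) _))
  factors : ∀ b c r f → r * r + 175 * (2 * (b * c) * (2 * (b * c))) ≡ (r + 2 * f) * (r + 2 * f) →
    4 * (f * (r + f)) ≡ 4 * (175 * (b * b * (c * c)))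
  factors b c r f eq = subtract-equation (sym eq) (identity b c r f)
    where
    identity : ∀ b c r f → 4 * (f * (r + f)) + (r * r + 175 * (2 * (b * c) * (2 * (b * c))))
      ≡ 4 * (175 * (b * b * (c * c))) + (r + 2 * f) * (r + 2 * f)
    identity = solve-∀
  sum : ∀ r f → f + (r + f) ≡ r + 2 * f
  sum = solve-∀
  finish : ∀ {s} → (∃[ f ] s ≡ r + 2 * f) → s ≡ b * b + 256 * (c * c) →
    r * r + 175 * (2 * (b * c) * (2 * (b * c))) ≡ s * s → SmallerEvenPoint c
  finish (f , refl) s≡ eq = descentFromFactors b c f (r + f) 0<c (≤-trans (odd⇒positive odd-r) (m≤m+n r f)) odd-b b⊥16c
    (*-cancelˡ-≡ _ _ 4 (factors b c r f eq)) (trans (sum r f) s≡)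

-- The numbers g = (s - p)/2 and p + g = (s + p)/2 have product (8 q)² and are coprime, as p is
-- coprime to 8 q, so both are squares. Their roots are, in one order or the other, an odd b and C =
-- 16 c with 8 q = b C.
descentCoprime : ∀ p q r s → Odd p → Coprime p q → 2 ∣ q → 0 < q →
  p * p + 81 * (q * q) ≡ r * r → p * p + 256 * (q * q) ≡ s * s →
  ∃[ q′ ] 0 < q′ × q′ < q × EvenPoint q′
descentCoprime p q r s odd-p p⊥q 2∣q 0<q r²≡ s²≡ = fromGap (odd-gap odd-p odd-s p≤s) s²≡ 175q²
  where
  2∣kq² : ∀ k → 2 ∣ k * (q * q)
  2∣kq² k = ∣n⇒∣m*n k (∣m⇒∣m*n q 2∣q)
  odd-r : Odd r
  odd-r = odd-root odd-p (2∣kq² 81) r²≡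
  odd-s : Odd s
  odd-s = odd-root odd-p (2∣kq² 256) s²≡
  p≤s : p ≤ s
  p≤s = square-cancel-≤ (subst (p * p ≤_) s²≡ (m≤m+n (p * p) _))
  175q² : r * r + 175 * (q * q) ≡ s * s
  175q² = trans (cong (_+ 175 * (q * q)) (sym r²≡)) (trans (add (p * p) (q * q)) s²≡)
    where
    add : ∀ P Q → P + 81 * Q + 175 * Q ≡ P + 256 * Q
    add = solve-∀

  p⊥8q : Coprime p (8 * q)
  p⊥8q = coprime-* {n = 8} (coprime-* {n = 2} p⊥2 (coprime-* {n = 2} p⊥2 p⊥2)) p⊥q
    where p⊥2 = odd⇒coprime-2 odd-p

  fromProduct : ∀ {s} b C → Odd b → Coprime b C → 8 * q ≡ b * C → s ≡ b * b + C * C →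
    r * r + 175 * (q * q) ≡ s * s → ∃[ q′ ] 0 < q′ × q′ < q × EvenPoint q′
  fromProduct {s} b C odd-b b⊥C 8q≡bC s≡ eq = finish 16∣C b⊥C 8q≡bC s≡
    where
    16∣C : 16 ∣ C
    -- Since q is even, 16 divides 8 q = b C, and b is odd.
    16∣C = coprime-divisor (Coprime.sym (coprime-* {n = 4} b⊥4 b⊥4)) (subst (16 ∣_) 8q≡bC (*-pres-∣ (∣-refl {8}) 2∣q))
      where
      b⊥2 = odd⇒coprime-2 odd-b
      b⊥4 = coprime-* {n = 2} b⊥2 b⊥2
    finish : ∀ {C} → 16 ∣ C → Coprime b C → 8 * q ≡ b * C → s ≡ b * b + C * C →
      ∃[ q′ ] 0 < q′ × q′ < q × EvenPoint q′
    finish (divides c refl) b⊥16c 8q≡16bc s≡ = conclude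
      (descentFromLegs b c r s 0<c odd-b (subst (Coprime b) (*-comm c 16) b⊥16c) odd-r
        (trans s≡ (expand b c)) (subst (λ q → r * r + 175 * (q * q) ≡ s * s) q≡2bc eq))
      where
      rescale : ∀ b c → b * (c * 16) ≡ 8 * (2 * (b * c))
      rescale = solve-∀
      expand : ∀ b c → b * b + c * 16 * (c * 16) ≡ b * b + 256 * (c * c)
      expand = solve-∀
      q≡2bc : q ≡ 2 * (b * c)
      q≡2bc = *-cancelˡ-≡ _ _ 8 (trans 8q≡16bc (rescale b c))
      0<bc : 0 < b * c
      0<bc = positiveʳ {2} (subst (0 <_) q≡2bc 0<q)
      0<c : 0 < c
      0<c = positiveʳ {b} 0<bc
      c<q : c < q
      c<q = subst (c <_) (sym q≡2bc) (≤-<-trans (m≤n*m c b {{>-nonZero (odd⇒positive odd-b)}})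
        (m<m+n (b * c) (≤-trans 0<bc (m≤m+n (b * c) 0))))
      conclude : SmallerEvenPoint c → ∃[ q′ ] 0 < q′ × q′ < q × EvenPoint q′
      conclude (q′ , 0<q′ , q′≤c , point) = q′ , 0<q′ , ≤-<-trans q′≤c c<q , point

  fromSplit : ∀ {g} → (∃[ x ] ∃[ y ] ∃[ g′ ] ∃[ f′ ]
      8 * q ≡ x * y × g ≡ x * x * g′ × p + g ≡ y * y * f′ × g′ * f′ ≡ 1) →
    Coprime g (p + g) → r * r + 175 * (q * q) ≡ (p + 2 * g) * (p + 2 * g) →
    ∃[ q′ ] 0 < q′ × q′ < q × EvenPoint q′
  fromSplit {g} (x , y , g′ , f′ , 8q≡xy , g≡ , f≡ , g′f′≡1) g⊥f eq = byParity (even⊎odd x)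
    where
    g≡x² : g ≡ x * x
    g≡x² = trans g≡ (trans (cong (x * x *_) (m*n≡1⇒m≡1 g′ f′ g′f′≡1)) (*-identityʳ (x * x)))
    f≡y² : p + g ≡ y * y
    f≡y² = trans f≡ (trans (cong (y * y *_) (m*n≡1⇒n≡1 g′ f′ g′f′≡1)) (*-identityʳ (y * y)))
    x⊥y : Coprime x y
    x⊥y = coprime-∣ˡ (subst (x ∣_) (sym g≡x²) (m∣m*n x)) (coprime-∣ʳ (subst (y ∣_) (sym f≡y²) (m∣m*n y)) g⊥f)
    regroup : ∀ p g → p + 2 * g ≡ g + (p + g)
    regroup = solve-∀
    s≡ : p + 2 * g ≡ x * x + y * y
    s≡ = trans (regroup p g) (cong₂ _+_ g≡x² f≡y²)
    byParity : 2 ∣ x ⊎ (∃[ k ] x ≡ 1 + 2 * k) → ∃[ q′ ] 0 < q′ × q′ < q × EvenPoint q′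
    byParity (inj₁ 2∣x) = fromProduct y x odd-y (Coprime.sym x⊥y) (trans 8q≡xy (*-comm x y))
      (trans s≡ (+-comm (x * x) (y * y))) eq
      where
      odd-y : Odd y
      odd-y 2∣y = contradiction (x⊥y (2∣x , 2∣y)) λ ()
    byParity (inj₂ (k , x≡1+2k)) =
      fromProduct x y (subst Odd (sym x≡1+2k) (1+2k-odd k)) x⊥y 8q≡xy s≡ eq

  fromGap : ∀ {s} → (∃[ g ] s ≡ p + 2 * g) → p * p + 256 * (q * q) ≡ s * s → r * r + 175 * (q * q) ≡ s * s →
    ∃[ q′ ] 0 < q′ × q′ < q × EvenPoint q′
  fromGap (g , refl) s²≡ eq = fromSplit (splitCoprime 1 (8 * q) (positive-* {8} z<s 0<q) g⊥f gf≡64q²) g⊥f eq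
    where
    identity : ∀ p q g → 4 * (g * (p + g)) + (p * p + 256 * (q * q))
      ≡ 4 * (1 * (8 * q * (8 * q))) + (p + 2 * g) * (p + 2 * g)
    identity = solve-∀
    gf≡64q² : g * (p + g) ≡ 1 * (8 * q * (8 * q))
    gf≡64q² = *-cancelˡ-≡ _ _ 4 (subtract-equation (sym s²≡) (identity p q g))
    g⊥f : Coprime g (p + g)
    g⊥f {d} (d∣g , d∣p+g) = coprime-* p⊥8q p⊥8q
      (∣m+n∣m⇒∣n (subst (d ∣_) (+-comm p g) d∣p+g) d∣g ,
       subst (d ∣_) (trans gf≡64q² (*-identityˡ _)) (∣m⇒∣m*n (p + g) d∣g))

divideSquares : ∀ k g a b r → 0 < g → g * a * (g * a) + k * (g * b * (g * b)) ≡ r * r →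
  ∃[ r′ ] a * a + k * (b * b) ≡ r′ * r′
divideSquares k g a b r 0<g eq = finish {r} (squares-∣⇒∣ 0<g (divides n (trans (sym eq) (regroup k g a b)))) eq
  where
  n = a * a + k * (b * b)
  regroup : ∀ k g a b → g * a * (g * a) + k * (g * b * (g * b)) ≡ (a * a + k * (b * b)) * (g * g)
  regroup = solve-∀
  finish : ∀ {r} → g ∣ r → g * a * (g * a) + k * (g * b * (g * b)) ≡ r * r → ∃[ r′ ] n ≡ r′ * r′
  finish (divides r′ refl) eq = r′ , *-cancelˡ-positive (positive-* 0<g 0<g)
    (conjugate eq (trans (*-comm (g * g) n) (sym (regroup k g a b))) (regroup′ g r′))
    where
    regroup′ : ∀ g r → r * g * (r * g) ≡ g * g * (r * r)
    regroup′ = solve-∀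

-- Infinite descent. An even point may have a common factor, whereas `descentCoprime` takes p and q
-- coprime, so each round first divides out the gcd.
noEvenPoint : ∀ q → 0 < q → ¬ EvenPoint q
noEvenPoint = <-rec _ step
  where
  step : ∀ q → (∀ {q′} → q′ < q → 0 < q′ → ¬ EvenPoint q′) → 0 < q → ¬ EvenPoint q
  step q rec 0<q (p , r , s , odd-p , 2∣q , r²≡ , s²≡) =
    reduce r s (coprimeFactors p 0<q) rec 0<q odd-p 2∣q r²≡ s²≡
    where
    reduce : ∀ {p q} r s →
      (∃[ g ] ∃[ p′ ] ∃[ q′ ] 0 < g × p ≡ g * p′ × q ≡ g * q′ × Coprime p′ q′) →
      (∀ {q′} → q′ < q → 0 < q′ → ¬ EvenPoint q′) → 0 < q → Odd p → 2 ∣ q →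
      p * p + 81 * (q * q) ≡ r * r → p * p + 256 * (q * q) ≡ s * s → ⊥
    reduce r s (g , p′ , q′ , 0<g , refl , refl , p′⊥q′) rec 0<gq′ odd-gp′ 2∣gq′ r²≡ s²≡ =
      let r′ , r′²≡ = divideSquares 81 g p′ q′ r 0<g r²≡
          s′ , s′²≡ = divideSquares 256 g p′ q′ s 0<g s²≡
          q″ , 0<q″ , q″<q′ , point = descentCoprime p′ q′ r′ s′ (odd-gp′ ∘ ∣n⇒∣m*n g) p′⊥q′
            -- The gcd divides the odd p, so the factor 2 of q remains in q′.
            ([ (λ 2∣g → contradiction (∣m⇒∣m*n p′ 2∣g) odd-gp′) , id ]′ (euclidsLemma g q′ 2-prime 2∣gq′))
            (positiveʳ {g} 0<gq′) r′²≡ s′²≡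
      in rec (<-≤-trans q″<q′ (m≤n*m q′ g {{>-nonZero 0<g}})) 0<q″ point

-- Points with odd denominator: duplication and translation by 4-torsion.

-- The double of u = 4 p/q is u′ = 8 (p⁴ − 81 q⁴)/(p q r s), with r² = 16 p² + 81 q² and s² = p² + 16 q².
-- For {a, a + 2 D} = {p², 9 q²} and n = 9 p q r s, the fraction n / (2 D (a + D)) is ± 144/u′.
duplicateGap : ∀ n a D → Odd n → 0 < a → 0 < D →
  n * n ≢ a * (a + 2 * D) * (25 * a + 32 * D) * (25 * a + 18 * D)
duplicateGap n a D odd-n 0<a 0<D n² = noEvenPoint (2 * (D * (a + D)))
  (positive-* {2} z<s (positive-* 0<D (≤-trans 0<a (m≤m+n a D))))
  -- With T = a (a + 2 D), n² is T (625 T + 576 D²) and the square of the denominator is 4 D² (T +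
  -- D²). The roots are therefore 25 T + 18 D² and 25 T + 32 D².
  ( n , 25 * (a * a) + 50 * (a * D) + 18 * (D * D) , 25 * (a * a) + 50 * (a * D) + 32 * (D * D)
  , odd-n , m∣m*n (D * (a + D))
  , trans (cong (_+ 81 * (2 * (D * (a + D)) * (2 * (D * (a + D))))) n²) (identity₁ a D)
  , trans (cong (_+ 256 * (2 * (D * (a + D)) * (2 * (D * (a + D))))) n²) (identity₂ a D))
  where
  identity₁ : ∀ a D → a * (a + 2 * D) * (25 * a + 32 * D) * (25 * a + 18 * D) + 81 * (2 * (D * (a + D)) * (2 * (D * (a + D))))
    ≡ (25 * (a * a) + 50 * (a * D) + 18 * (D * D)) * (25 * (a * a) + 50 * (a * D) + 18 * (D * D))
  identity₁ = solve-∀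
  identity₂ : ∀ a D → a * (a + 2 * D) * (25 * a + 32 * D) * (25 * a + 18 * D) + 256 * (2 * (D * (a + D)) * (2 * (D * (a + D))))
    ≡ (25 * (a * a) + 50 * (a * D) + 32 * (D * D)) * (25 * (a * a) + 50 * (a * D) + 32 * (D * D))
  identity₂ = solve-∀

duplicateOrdered : ∀ n a b → Odd n → Odd a → Odd b → a < b →
  n * n ≢ a * b * (9 * a + 16 * b) * (16 * a + 9 * b)
duplicateOrdered n a b odd-n odd-a odd-b a<b = finish (odd-gap odd-a odd-b (<⇒≤ a<b)) a<b
  where
  identity : ∀ a D → a * (a + 2 * D) * (9 * a + 16 * (a + 2 * D)) * (16 * a + 9 * (a + 2 * D))
    ≡ a * (a + 2 * D) * (25 * a + 32 * D) * (25 * a + 18 * D)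
  identity = solve-∀
  finish : ∀ {b} → (∃[ D ] b ≡ a + 2 * D) → a < b → n * n ≢ a * b * (9 * a + 16 * b) * (16 * a + 9 * b)
  finish (D , refl) a<b n² = duplicateGap n a D odd-n (odd⇒positive odd-a)
    (positiveʳ {2} (+-cancelˡ-< a 0 (2 * D) (subst (_< a + 2 * D) (sym (+-identityʳ a)) a<b)))
    (trans n² (identity a D))

-- The product is symmetric, so a strict inequality in either direction yields an even point with
-- nonzero denominator.
duplicate : ∀ n a b → Odd n → Odd a → Odd b →
  n * n ≡ a * b * (9 * a + 16 * b) * (16 * a + 9 * b) → a ≡ b
duplicate n a b odd-n odd-a odd-b n² = byOrder (<-cmp a b)
  where
  swap : ∀ a b → a * b * (9 * a + 16 * b) * (16 * a + 9 * b) ≡ b * a * (9 * b + 16 * a) * (16 * b + 9 * a)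
  swap = solve-∀
  byOrder : Tri (a < b) (a ≡ b) (b < a) → a ≡ b
  byOrder (tri< a<b _ _) = contradiction n² (duplicateOrdered n a b odd-n odd-a odd-b a<b)
  byOrder (tri≈ _ a≡b _) = a≡b
  byOrder (tri> _ _ b<a) = contradiction (trans n² (swap a b)) (duplicateOrdered n b a odd-n odd-b odd-a b<a)

-- This is the point u = 4 p/q. Duplication with a = p², b = 9 q² and n = 9 p q r s forces p² = 9
-- q², that is u = 12.
quarterOdd : ∀ p q r s → Odd p → Odd q → 16 * (p * p) + 81 * (q * q) ≡ r * r → p * p + 16 * (q * q) ≡ s * s →
  p ≡ 3 * q
quarterOdd p q r s odd-p odd-q r² s² = square-injective (trans
  (duplicate (9 * (p * q * r * s)) (p * p) (9 * (q * q))
    (odd-* (1+2k-odd 4) (odd-* (odd-* (odd-* odd-p odd-q) odd-r) odd-s))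
    (odd-* odd-p odd-p) (odd-* (1+2k-odd 4) (odd-* odd-q odd-q))
    (trans (square p q r s) (trans (cong₂ (λ R S → 81 * (p * p) * (q * q) * R * S) (sym r²) (sym s²)) (expand (p * p) (q * q)))))
  (nine q))
  where
  odd-s : Odd s
  odd-s = odd-root odd-p (∣m⇒∣m*n (q * q) (divides 8 refl)) s²
  odd-r : Odd r
  odd-r = odd-root (odd-* (1+2k-odd 4) odd-q) (∣m⇒∣m*n (p * p) (divides 8 refl))
    (trans (cong (_+ 16 * (p * p)) (81q² q)) (trans (+-comm (81 * (q * q)) (16 * (p * p))) r²))
    where
    81q² : ∀ q → 9 * q * (9 * q) ≡ 81 * (q * q)
    81q² = solve-∀
  square : ∀ p q r s → 9 * (p * q * r * s) * (9 * (p * q * r * s)) ≡ 81 * (p * p) * (q * q) * (r * r) * (s * s)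
  square = solve-∀
  expand : ∀ P Q → 81 * P * Q * (16 * P + 81 * Q) * (P + 16 * Q)
    ≡ P * (9 * Q) * (9 * P + 16 * (9 * Q)) * (16 * P + 9 * (9 * Q))
  expand = solve-∀
  nine : ∀ q → 9 * (q * q) ≡ 3 * q * (3 * q)
  nine = solve-∀

≢-mod-8 : ∀ a b → 1 + 8 * a ≢ 5 + 8 * b
≢-mod-8 a b eq = from-no (8 ∣? 4) (∣-difference 8 b 4 a (sym (+-cancelˡ-≡ 1 _ _ (trans eq (rearrange b)))))
  where
  rearrange : ∀ b → 5 + 8 * b ≡ 1 + (8 * b + 4)
  rearrange = solve-∀

sumOfOddSquares : ∀ {p q} r → Odd p → Odd q → p * p + q * q ≢ r * r
sumOfOddSquares {p} {q} r odd-p odd-q eq =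
  let a , p² = odd-square odd-p
      b , q² = odd-square odd-q
  in odd-*-square≢2+8k r (a + b) (1+2k-odd 0)
       (trans (*-identityˡ (r * r)) (trans (sym eq) (trans (cong₂ _+_ p² q²) (collect a b))))
  where
  collect : ∀ a b → 1 + 8 * a + (1 + 8 * b) ≡ 2 + 8 * (a + b)
  collect = solve-∀

evenRoot : ∀ {k r} → 2 * 2 * k ≡ r * r → ∃[ s ] r ≡ s * 2 × k ≡ s * s
evenRoot {k} {r} eq = finish (squares-∣⇒∣ {2} z<s (divides k (trans (sym eq) (*-comm 4 k)))) eq
  where
  finish : ∀ {r} → 2 ∣ r → 2 * 2 * k ≡ r * r → ∃[ s ] r ≡ s * 2 × k ≡ s * s
  finish (divides s refl) eq = s , refl , *-cancelˡ-≡ k (s * s) 4 (trans eq (regroup s))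
    where
    regroup : ∀ s → s * 2 * (s * 2) ≡ 4 * (s * s)
    regroup = solve-∀

halve : ∀ k p q r → p * 2 * (p * 2) + 4 * k * (q * q) ≡ r * r → ∃[ s ] p * p + k * (q * q) ≡ s * s
halve k p q r eq =
  let s , _ , eq′ = evenRoot {p * p + k * (q * q)} {r} (trans (regroup k p q) eq) in s , eq′
  where
  regroup : ∀ k p q → 2 * 2 * (p * p + k * (q * q)) ≡ p * 2 * (p * 2) + 4 * k * (q * q)
  regroup = solve-∀

-- Halving leaves p² + 4 q², which is 5 modulo 8 for odd p. For even p halving again leaves (p/2)² +
-- q², which is 2 modulo 8 for odd p/2. So 4 divides p.
evenQuarter : ∀ p q s → Odd q → p * 2 * (p * 2) + 16 * (q * q) ≡ s * s →
  ∃[ h ] p ≡ h * 2 * 2 × (∃[ t ] h * 2 * (h * 2) + q * q ≡ t * t)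
evenQuarter p q s odd-q eq = let t , eq′ = halve 4 p q s eq in byParity t (even⊎odd p) eq′
  where
  step₁ : ∀ {p t} → Odd p → p * p + 4 * (q * q) ≢ t * t
  step₁ {p} {t} odd-p eq =
    let a , p² = odd-square odd-p
        b , q² = odd-square odd-q
        c , t² = odd-square (odd-root {r = t} odd-p (∣m⇒∣m*n (q * q) (divides 2 refl)) eq)
    in ≢-mod-8 c (a + 4 * b) (trans (sym t²) (trans (sym eq) (trans (cong₂ (λ P Q → P + 4 * Q) p² q²) (collect a b))))
    where
    collect : ∀ a b → 1 + 8 * a + 4 * (1 + 8 * b) ≡ 5 + 8 * (a + 4 * b)
    collect = solve-∀
  step₂ : ∀ p t → 2 ∣ p ⊎ (∃[ k ] p ≡ 1 + 2 * k) → p * p + 1 * (q * q) ≡ t * t →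
    ∃[ h ] p * 2 ≡ h * 2 * 2 × (∃[ t ] h * 2 * (h * 2) + q * q ≡ t * t)
  step₂ _ t (inj₁ (divides h refl)) eq = h , refl , t , trans (cong (λ n → h * 2 * (h * 2) + n) (sym (*-identityˡ (q * q)))) eq
  step₂ _ t (inj₂ (k , refl)) eq = contradiction
    (trans (cong (λ n → (1 + 2 * k) * (1 + 2 * k) + n) (sym (*-identityˡ (q * q)))) eq)
    (sumOfOddSquares t (1+2k-odd k) odd-q)
  byParity : ∀ {p} t → 2 ∣ p ⊎ (∃[ k ] p ≡ 1 + 2 * k) → p * p + 4 * (q * q) ≡ t * t →
    ∃[ h ] p ≡ h * 2 * 2 × (∃[ t ] h * 2 * (h * 2) + q * q ≡ t * t)
  byParity t (inj₁ (divides p refl)) eq =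
    let t′ , eq′ = halve 1 p q t eq in step₂ p t′ (even⊎odd p) eq′
  byParity t (inj₂ (k , refl)) eq = contradiction eq (step₁ {t = t} (1+2k-odd k))

-- For u = 32 h/q the translate 144/u = 9 q/(2 h) has odd numerator and even denominator, so it
-- cannot exist with h positive.
swappedEvenPoint : ∀ h q r t → Odd q → h * 32 * (h * 32) + 81 * (q * q) ≡ r * r → h * 2 * (h * 2) + q * q ≡ t * t →
  h ≡ 0
swappedEvenPoint h q r t odd-q r² t² = n≮0⇒n≡0 λ 0<h → noEvenPoint (h * 2) (positive-* 0<h z<s)
  (9 * q , 9 * t , r , odd-* (1+2k-odd 4) odd-q , n∣m*n h ,
   trans (identity₁ h q) (trans (cong (81 *_) t²) (square t)) , trans (identity₂ h q) r²)
  where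
  n≮0⇒n≡0 : ∀ {n} → ¬ 0 < n → n ≡ 0
  n≮0⇒n≡0 {zero}  _    = refl
  n≮0⇒n≡0 {suc n} 0≮n = contradiction z<s 0≮n
  identity₁ : ∀ h q → 9 * q * (9 * q) + 81 * (h * 2 * (h * 2)) ≡ 81 * (h * 2 * (h * 2) + q * q)
  identity₁ = solve-∀
  identity₂ : ∀ h q → 9 * q * (9 * q) + 256 * (h * 2 * (h * 2)) ≡ h * 32 * (h * 32) + 81 * (q * q)
  identity₂ = solve-∀
  square : ∀ t → 81 * (t * t) ≡ 9 * t * (9 * t)
  square = solve-∀

-- Cases by powers of 2. An even q is excluded by `noEvenPoint`, odd p and q by p² + (9 q)² ≡ 2
-- modulo 8. Otherwise 4 divides p: an odd p/4 gives u = 12 by `quarterOdd`, an even one u = 0 by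
-- `swappedEvenPoint`.
classifyCoprime : ∀ p q r s → Coprime p q → 0 < q →
  p * p + 81 * (q * q) ≡ r * r → p * p + 256 * (q * q) ≡ s * s → p ≡ 0 ⊎ p ≡ 12 * q
classifyCoprime p q r s p⊥q 0<q r² s² = [ evenDenominator , oddDenominator ]′ (even⊎odd q)
  where
  evenDenominator : 2 ∣ q → p ≡ 0 ⊎ p ≡ 12 * q
  evenDenominator 2∣q = contradiction
    (p , r , s , (λ 2∣p → contradiction (p⊥q (2∣p , 2∣q)) λ ()) , 2∣q , r² , s²) (noEvenPoint q 0<q)

  byQuarter : ∀ {p} → Odd q → 2 ∣ p ⊎ (∃[ k ] p ≡ 1 + 2 * k) →
    p * 4 * (p * 4) + 81 * (q * q) ≡ r * r → (∃[ s ] p * p + 16 * (q * q) ≡ s * s) → p * 4 ≡ 0 ⊎ p * 4 ≡ 12 * q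
  byQuarter odd-q (inj₁ (divides p refl)) r² (s , s²) =
    finish (evenQuarter p q s odd-q s²) r²
    where
    finish : ∀ {p} → (∃[ h ] p ≡ h * 2 * 2 × (∃[ t ] h * 2 * (h * 2) + q * q ≡ t * t)) →
      p * 2 * 4 * (p * 2 * 4) + 81 * (q * q) ≡ r * r → p * 2 * 4 ≡ 0 ⊎ p * 2 * 4 ≡ 12 * q
    finish (h , refl , t , t²) r² = inj₁ (cong (λ h → h * 2 * 2 * 2 * 4)
      (swappedEvenPoint h q r t odd-q (trans (regroup h q) r²) t²))
      where
      regroup : ∀ h q → h * 32 * (h * 32) + 81 * (q * q) ≡ h * 2 * 2 * 2 * 4 * (h * 2 * 2 * 2 * 4) + 81 * (q * q)
      regroup = solve-∀
  byQuarter odd-q (inj₂ (k , refl)) r² (s , s²) = inj₂ (trans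
    (cong (_* 4) (quarterOdd (1 + 2 * k) q r s (1+2k-odd k) odd-q (trans (regroup (1 + 2 * k) q) r²) s²))
    (twelve q))
    where
    regroup : ∀ p q → 16 * (p * p) + 81 * (q * q) ≡ p * 4 * (p * 4) + 81 * (q * q)
    regroup = solve-∀
    twelve : ∀ q → 3 * q * 4 ≡ 12 * q
    twelve = solve-∀

  -- Modulo 8 both 81 q² and r² are 1, so 4 p² is 0.
  quarter : ∀ p → Odd q → p * 2 * (p * 2) + 81 * (q * q) ≡ r * r → 2 ∣ p
  quarter p odd-q r² = square-even (evenSquare (odd-square odd-q) (odd-square odd-r))
    where
    81q² : ∀ p q → 9 * q * (9 * q) + p * 2 * (p * 2) ≡ p * 2 * (p * 2) + 81 * (q * q)
    81q² = solve-∀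
    odd-r : Odd r
    odd-r = odd-root (odd-* (1+2k-odd 4) odd-q) (∣m⇒∣m*n (p * 2) (n∣m*n p)) (trans (81q² p q) r²)
    evenSquare : (∃[ a ] q * q ≡ 1 + 8 * a) → (∃[ b ] r * r ≡ 1 + 8 * b) → 2 ∣ p * p
    evenSquare (a , q²) (b , r²≡) = ∣-difference 2 (10 + 81 * a) (p * p) b
      (*-cancelˡ-≡ _ _ 4 (+-cancelˡ-≡ 1 _ _
        (trans (identity p a) (trans (cong (λ Q → p * 2 * (p * 2) + 81 * Q) (sym q²)) (trans r² (trans r²≡ (8b b)))))))
      where
      identity : ∀ p a → 1 + 4 * (2 * (10 + 81 * a) + p * p) ≡ p * 2 * (p * 2) + 81 * (1 + 8 * a)
      identity = solve-∀
      8b : ∀ b → 1 + 8 * b ≡ 1 + 4 * (2 * b)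
      8b = solve-∀

  byNumerator : ∀ {p} → Odd q → 2 ∣ p ⊎ (∃[ k ] p ≡ 1 + 2 * k) →
    p * p + 81 * (q * q) ≡ r * r → p * p + 256 * (q * q) ≡ s * s → p ≡ 0 ⊎ p ≡ 12 * q
  byNumerator odd-q (inj₂ (k , refl)) r² _ = contradiction
    (trans (cong (λ n → (1 + 2 * k) * (1 + 2 * k) + n) (81q² q)) r²)
    (sumOfOddSquares r (1+2k-odd k) (odd-* (1+2k-odd 4) odd-q))
    where
    81q² : ∀ q → 9 * q * (9 * q) ≡ 81 * (q * q)
    81q² = solve-∀
  byNumerator odd-q (inj₁ (divides p refl)) r² s² = finish (quarter p odd-q r²) r² s²
    where
    finish : ∀ {p} → 2 ∣ p → p * 2 * (p * 2) + 81 * (q * q) ≡ r * r → p * 2 * (p * 2) + 256 * (q * q) ≡ s * s →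
      p * 2 ≡ 0 ⊎ p * 2 ≡ 12 * q
    finish (divides p refl) r² s² =
      -- Two halvings take the coefficient of q² from 256 through 64 to 16.
      let t , t² = halve 64 (p * 2) q s s²
          u , u² = halve 16 p q t t²
      in subst (λ n → n ≡ 0 ⊎ n ≡ 12 * q) (sym (*-assoc p 2 2))
           (byQuarter odd-q (even⊎odd p) (trans (regroup p q) r²) (u , u²))
      where
      regroup : ∀ p q → p * 4 * (p * 4) + 81 * (q * q) ≡ p * 2 * 2 * (p * 2 * 2) + 81 * (q * q)
      regroup = solve-∀

  oddDenominator : (∃[ k ] q ≡ 1 + 2 * k) → p ≡ 0 ⊎ p ≡ 12 * q
  oddDenominator (k , q≡) = byNumerator (subst Odd (sym q≡) (1+2k-odd k)) (even⊎odd p) r² s²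

classify : ∀ p q r s → 0 < q →
  p * p + 81 * (q * q) ≡ r * r → p * p + 256 * (q * q) ≡ s * s → p ≡ 0 ⊎ p ≡ 12 * q
classify p q r s 0<q = reduce (coprimeFactors p 0<q) 0<q
  where
  reduce : ∀ {p q} →
    (∃[ g ] ∃[ p′ ] ∃[ q′ ] 0 < g × p ≡ g * p′ × q ≡ g * q′ × Coprime p′ q′) → 0 < q →
    p * p + 81 * (q * q) ≡ r * r → p * p + 256 * (q * q) ≡ s * s → p ≡ 0 ⊎ p ≡ 12 * q
  reduce (g , p′ , q′ , 0<g , refl , refl , p′⊥q′) 0<gq′ r² s² =
    let r′ , r′² = divideSquares 81 g p′ q′ r 0<g r²
        s′ , s′² = divideSquares 256 g p′ q′ s 0<g s²
    in map (λ p′≡0 → trans (cong (g *_) p′≡0) (*-zeroʳ g)) (λ p′≡12q′ → trans (cong (g *_) p′≡12q′) (regroup g q′))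
         (classifyCoprime p′ q′ r′ s′ p′⊥q′ (positiveʳ {g} 0<gq′) r′² s′²)
    where
    regroup : ∀ g q → g * (12 * q) ≡ 12 * (g * q)
    regroup = solve-∀

-- From rational numbers to natural numbers.

square-∣-∣ : ∀ i → i ℤ.* i ≡ + (ℤ.∣ i ∣ * ℤ.∣ i ∣)
square-∣-∣ (+ n)    = sym (ℤ.pos-* n n)
square-∣-∣ -[1+ n ] = refl

-- Numerators occur only squared, so absolute values may replace them. The shape is that of an
-- equality of unnormalised fractions after cross-multiplication.
natEquation : ∀ i j k a b c e →
  i ℤ.* i ℤ.* + a ≡ (j ℤ.* j ℤ.* + b ℤ.+ + k ℤ.* + k ℤ.* + c) ℤ.* + e →
  ℤ.∣ i ∣ * ℤ.∣ i ∣ * a ≡ (ℤ.∣ j ∣ * ℤ.∣ j ∣ * b + k * k * c) * e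
natEquation i j k a b c e eq = ℤ.+-injective (begin
  + (ℤ.∣ i ∣ * ℤ.∣ i ∣ * a)                                    ≡⟨ scale i a ⟨
  i ℤ.* i ℤ.* + a                                          ≡⟨ eq ⟩
  (j ℤ.* j ℤ.* + b ℤ.+ + k ℤ.* + k ℤ.* + c) ℤ.* + e      ≡⟨ cong (ℤ._* + e) (cong₂ ℤ._+_ (scale j b) (scale (+ k) c)) ⟩
  + (ℤ.∣ j ∣ * ℤ.∣ j ∣ * b + k * k * c) ℤ.* + e               ≡⟨ ℤ.pos-* (ℤ.∣ j ∣ * ℤ.∣ j ∣ * b + k * k * c) e ⟨
  + ((ℤ.∣ j ∣ * ℤ.∣ j ∣ * b + k * k * c) * e)                 ∎)
  where
  open ≡-Reasoning
  scale : ∀ i a → i ℤ.* i ℤ.* + a ≡ + (ℤ.∣ i ∣ * ℤ.∣ i ∣ * a)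
  scale i a = trans (cong (ℤ._* + a) (square-∣-∣ i)) (sym (ℤ.pos-* (ℤ.∣ i ∣ * ℤ.∣ i ∣) a))

-- With X = m/D and d = n/E the equation is (m² + k² D²) E² = n² D². Hence E divides n D, and r is
-- the quotient.
clearDenominators : ∀ X d k → d ℚ.* d ≡ X ℚ.* X ℚ.+ fromℤ (+ k) ℚ.* fromℤ (+ k) →
  ∃[ r ] ℤ.∣ ↥ X ∣ * ℤ.∣ ↥ X ∣ + k * ↧ₙ X * (k * ↧ₙ X) ≡ r * r
clearDenominators X@record{} d@record{} k d² =
  root (squares-∣⇒∣ {↧ₙ d} {ℤ.∣ ↥ d ∣ * ↧ₙ X} z<s
    (divides (ℤ.∣ ↥ X ∣ * ℤ.∣ ↥ X ∣ + k * ↧ₙ X * (k * ↧ₙ X)) (sym nat))) nat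
  where
  d²ᵘ : ℚ.toℚᵘ d ℚᵘ.* ℚ.toℚᵘ d ℚᵘ.≃ ℚ.toℚᵘ X ℚᵘ.* ℚ.toℚᵘ X ℚᵘ.+ ℚ.toℚᵘ (fromℤ (+ k)) ℚᵘ.* ℚ.toℚᵘ (fromℤ (+ k))
  d²ᵘ = begin
    ℚ.toℚᵘ d ℚᵘ.* ℚ.toℚᵘ d
      ≈⟨ ℚ.toℚᵘ-homo-* d d ⟨
    ℚ.toℚᵘ (d ℚ.* d)
      ≡⟨ cong ℚ.toℚᵘ d² ⟩
    ℚ.toℚᵘ (X ℚ.* X ℚ.+ fromℤ (+ k) ℚ.* fromℤ (+ k))
      ≈⟨ ℚ.toℚᵘ-homo-+ (X ℚ.* X) (fromℤ (+ k) ℚ.* fromℤ (+ k)) ⟩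
    ℚ.toℚᵘ (X ℚ.* X) ℚᵘ.+ ℚ.toℚᵘ (fromℤ (+ k) ℚ.* fromℤ (+ k))
      ≈⟨ ℚᵘ.+-cong (ℚ.toℚᵘ-homo-* X X) (ℚ.toℚᵘ-homo-* (fromℤ (+ k)) (fromℤ (+ k))) ⟩
    ℚ.toℚᵘ X ℚᵘ.* ℚ.toℚᵘ X ℚᵘ.+ ℚ.toℚᵘ (fromℤ (+ k)) ℚᵘ.* ℚ.toℚᵘ (fromℤ (+ k)) ∎
    where open ℚᵘ.≃-Reasoning
  -- The factors `1 * 1` come from the denominator of `fromℤ (+ k)`.
  regroup : ∀ n m k D E → n * n * (D * D * (1 * 1)) ≡ (m * m * (1 * 1) + k * k * (D * D)) * (E * E) →
    (m * m + k * D * (k * D)) * (E * E) ≡ n * D * (n * D)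
  regroup n m k D E eq = conjugate (sym eq) (left m k D E) (right n D)
    where
    left : ∀ m k D E → (m * m + k * D * (k * D)) * (E * E) ≡ (m * m * (1 * 1) + k * k * (D * D)) * (E * E)
    left = solve-∀
    right : ∀ n D → n * n * (D * D * (1 * 1)) ≡ n * D * (n * D)
    right = solve-∀
  nat : (ℤ.∣ ↥ X ∣ * ℤ.∣ ↥ X ∣ + k * ↧ₙ X * (k * ↧ₙ X)) * (↧ₙ d * ↧ₙ d) ≡ ℤ.∣ ↥ d ∣ * ↧ₙ X * (ℤ.∣ ↥ d ∣ * ↧ₙ X)
  nat = regroup (ℤ.∣ ↥ d ∣) (ℤ.∣ ↥ X ∣) k (↧ₙ X) (↧ₙ d)
    (natEquation (↥ d) (↥ X) k (↧ₙ X * ↧ₙ X * (1 * 1)) (1 * 1) (↧ₙ X * ↧ₙ X) (↧ₙ d * ↧ₙ d) (ℚᵘ.drop-*≡* d²ᵘ))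
  root : ∀ {m E n} → suc E ∣ n → m * (suc E * suc E) ≡ n * n → ∃[ r ] m ≡ r * r
  root {m} {E} (divides r refl) eq = r , *-cancelʳ-≡ m (r * r) (suc E * suc E)
    (trans eq ([m*n]*[o*p]≡[m*o]*[n*p] r (suc E) r (suc E)))

-- The number u = |X|/16 is taken with denominator 16 D, where D is that of X: 81 (16 D)² = (144 D)²
-- and 256 (16 D)² = (256 D)². The value u = 12 becomes |X| = 192.
concordant : ∀ X d e → d ℚ.* d ≡ X ℚ.* X ℚ.+ fromℤ (+ 144) ℚ.* fromℤ (+ 144) →
  e ℚ.* e ≡ X ℚ.* X ℚ.+ fromℤ (+ 256) ℚ.* fromℤ (+ 256) →
  ℤ.∣ ↥ X ∣ ≡ 0 ⊎ ℤ.∣ ↥ X ∣ ≡ 192 * ↧ₙ X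
concordant X@record{} d e d² e² =
  let r , r² = clearDenominators X d 144 d²
      s , s² = clearDenominators X e 256 e²
  in map id (λ eq → trans eq (192q (↧ₙ X)))
       (classify (ℤ.∣ ↥ X ∣) (16 * ↧ₙ X) r s z<s
         (trans (cong (λ n → ℤ.∣ ↥ X ∣ * ℤ.∣ ↥ X ∣ + n) (144q (↧ₙ X))) r²) (trans (cong (λ n → ℤ.∣ ↥ X ∣ * ℤ.∣ ↥ X ∣ + n) (256q (↧ₙ X))) s²))
  where
  192q : ∀ q → 12 * (16 * q) ≡ 192 * q
  192q = solve-∀
  144q : ∀ q → 81 * (16 * q * (16 * q)) ≡ 144 * q * (144 * q)
  144q = solve-∀
  256q : ∀ q → 256 * (16 * q * (16 * q)) ≡ 256 * q * (256 * q)
  256q = solve-∀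

-- The points of the open segment.

onlyCentre : ∀ X → fromℤ (ℤ.- + 192) ℚ.< X → X ℚ.< fromℤ (+ 192) →
  ℤ.∣ ↥ X ∣ ≡ 0 ⊎ ℤ.∣ ↥ X ∣ ≡ 192 * ↧ₙ X → X ≡ 0ℚ
onlyCentre X lower upper (inj₁ ∣X∣≡0) = ℚ.↥p≡0⇒p≡0 X (ℤ.∣i∣≡0⇒i≡0 ∣X∣≡0)
-- The values 192 and -192 are the end points V and U, which the strict bounds exclude.
onlyCentre X@(mkℚ (+ n) _ _) _ upper (inj₂ n≡) = contradiction
  (ℚ.drop-*<* upper) (ℤ.<-irrefl (trans (ℤ.*-identityʳ (+ n)) (trans (cong +_ n≡) (ℤ.pos-* 192 (↧ₙ X)))))
onlyCentre X@(mkℚ -[1+ n ] _ _) lower _ (inj₂ n≡) = contradiction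
  (ℚ.drop-*<* lower) (ℤ.<-irrefl (sym (trans (ℤ.*-identityʳ -[1+ n ]) (trans (cong (ℤ.-_ ∘ +_) n≡)
    (trans (cong ℤ.-_ (ℤ.pos-* 192 (↧ₙ X))) (ℤ.neg-distribˡ-* (+ 192) (+ ↧ₙ X)))))))

onSegment : ∀ {t d e} → 0ℚ ℚ.< t → t ℚ.< 1ℚ →
  let P = ⟨ x U ℚ.+ t ℚ.* (x V ℚ.- x U) , y U ℚ.+ t ℚ.* (y V ℚ.- y U) ⟩ in
  d ℚ.* d ≡ distance² P A → e ℚ.* e ≡ distance² P B → P ≡ ⟨ fromℤ (+ 192) , 0ℚ ⟩
onSegment {t} {d} {e} 0<t t<1 dA dB = cong₂ ⟨_,_⟩ x≡192 y≡0
  where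
  xP = 0ℚ ℚ.+ t ℚ.* fromℤ (+ 384)
  yP = 0ℚ ℚ.+ t ℚ.* 0ℚ
  X = xP ℚ.- fromℤ (+ 192)
  y≡0 : yP ≡ 0ℚ
  y≡0 = trans (ℚ.+-identityˡ (t ℚ.* 0ℚ)) (ℚ.*-zeroʳ t)
  -- At t = 0 and t = 1 the shifted abscissa evaluates to -192 and 192, the bounds in `onlyCentre`.
  shift : ∀ {p q} → p ℚ.< q → 0ℚ ℚ.+ p ℚ.* fromℤ (+ 384) ℚ.- fromℤ (+ 192) ℚ.< 0ℚ ℚ.+ q ℚ.* fromℤ (+ 384) ℚ.- fromℤ (+ 192)
  shift p<q = ℚ.+-monoˡ-< _ (ℚ.+-monoʳ-< 0ℚ (ℚ.*-monoˡ-<-pos (fromℤ (+ 384)) p<q))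
  X≡0 : X ≡ 0ℚ
  X≡0 = onlyCentre X (shift 0<t) (shift t<1) (concordant X d e
    -- For y = 0 the terms (0 - 144)² and (0 + 256)² evaluate to 144² and 256².
    (trans dA (cong (λ y → X ℚ.* X ℚ.+ (y ℚ.- fromℤ (+ 144)) ℚ.* (y ℚ.- fromℤ (+ 144))) y≡0))
    (trans dB (cong (λ y → X ℚ.* X ℚ.+ (y ℚ.- fromℤ (ℤ.- + 256)) ℚ.* (y ℚ.- fromℤ (ℤ.- + 256))) y≡0)))
  x≡192 : xP ≡ fromℤ (+ 192)
  x≡192 = begin
    xP                                             ≡⟨ ℚ.+-identityʳ xP ⟨
    xP ℚ.+ 0ℚ                                      ≡⟨ ℚ.+-assoc xP (ℚ.- fromℤ (+ 192)) (fromℤ (+ 192)) ⟨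
    X ℚ.+ fromℤ (+ 192)                            ≡⟨ cong (ℚ._+ fromℤ (+ 192)) X≡0 ⟩
    fromℤ (+ 192)                                  ∎
    where open ≡-Reasoning

theorem5p3 : (λ P → OpenSegment U V P × RationalDistance P U × RationalDistance P V × RationalDistance P A × RationalDistance P B)
    ≐ ｛ ⟨ fromℤ (+ 192) , fromℤ (+ 0) ⟩ ｝
theorem5p3 =
  (λ { ((_ , 0<t , t<1 , refl) , _ , _ , (d , _ , dA) , (e , _ , dB)) → sym (onSegment {d = d} {e} 0<t t<1 dA dB) }) ,
  (λ { refl → (ℚ.½ , from-yes (0ℚ ℚ.<? ℚ.½) , from-yes (ℚ.½ ℚ.<? 1ℚ) , refl)
            , (fromℤ (+ 192) , from-yes (0ℚ ℚ.≤? fromℤ (+ 192)) , refl)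
            , (fromℤ (+ 192) , from-yes (0ℚ ℚ.≤? fromℤ (+ 192)) , refl)
            , (fromℤ (+ 144) , from-yes (0ℚ ℚ.≤? fromℤ (+ 144)) , refl)
            , (fromℤ (+ 256) , from-yes (0ℚ ℚ.≤? fromℤ (+ 256)) , refl) })
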